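{- If $\Sigma_1$ and $\Sigma_2$ denote the antibalanced signed complete graph $K_m^-$ and the all-negative signed complete graph $-K_n$ respectively, then the HG-lexicographic product satisfies $\operatorname{bdim}(\Sigma_1[\Sigma_2])=\bar\nu(mn)$, where $\bar\nu(mn)$ is the balancing dimension of the antibalanced signed complete graph $K_{mn}^-$.
   Context: A signed graph $\Sigma=(G,\sigma)$ is a graph $G=(V,E)$ with a function $\sigma:E\to\{+1,-1\}$. The sign of a cycle is the product of the signs of its edges; $\Sigma$ is balanced if it has no cycle of sign $-1$, and antibalanced if $-\Sigma=(G,-\sigma)$ is balanced. Let $\Omega=\{ -1,0,1\}$, with $\Omega^k\subset\mathbb{R}^k$ carrying the standard inner product $\langle\cdot,\cdot\rangle$. A vector valued switching function ($k$-switching function) for $\Sigma$ is a map $\zeta:V\to\Omega^k$ with $\langle\zeta(u),\zeta(v)\rangle\neq 0$ for every edge $uv\in E$; the switched signed graph $\Sigma^\zeta=(G,\sigma^\zeta)$ has $\sigma^\zeta(uv)=\sigma(uv)\operatorname{sgn}(\langle\zeta(u),\zeta(v)\rangle)$. The balancing dimension $\operatorname{bdim}(\Sigma)$ is the least integer $k\ge 1$ for which there is a $k$-switching function $\zeta:V\to\Omega^k$ such that $\Sigma^\zeta$ is all-positive (every edge has sign $+1$). $K_n^-$ denotes an antibalanced signed graph whose underlying graph is the complete graph $K_n$, and $\bar\nu(n)=\operatorname{bdim}(K_n^-)$ (independent of the choice of antibalanced signature, since all antibalanced signatures on $K_n$ are equivalent under ordinary $\{\pm1\}$-switching, which preserves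 $\operatorname{bdim}$). $-K_n$ is $K_n$ with every edge of sign $-1$. The lexicographic product $G_1[G_2]$ of graphs has vertex set $V(G_1)\times V(G_2)$, with $(u_i,v_j)$ adjacent to $(u_k,v_l)$ iff $u_i\sim u_k$ in $G_1$, or $u_i=u_k$ and $v_j\sim v_l$ in $G_2$. The HG-lexicographic product $\Sigma_1[\Sigma_2]$ of $\Sigma_1=(G_1,\sigma_1)$ and $\Sigma_2=(G_2,\sigma_2)$ is the signed graph on $G_1[G_2]$ with signature $\sigma((u_i,v_j)(u_k,v_l))=\sigma_1(u_iu_k)$ if $i\ne k$, and $=\sigma_2(v_jv_l)$ if $i=k$. -}

module Defs where

open import Data.Empty using (⊥-elim; ⊥-elim-irr)
open import Data.Fin as Fin using (Fin; zero; suc; remQuot; combine)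
import Data.Fin.Properties as Fin
open import Data.Integer as ℤ using (ℤ; 0ℤ; 1ℤ; -1ℤ)
import Data.Integer.Properties as ℤ
open import Data.List as List using (List)
open import Data.List.Relation.Unary.Unique.Propositional using (Unique)
open import Data.Nat as ℕ using (ℕ; zero; suc; _≤_; z≤n; s≤s)
import Data.Nat.Properties as ℕ
open import Data.Product using (Σ; ∃; _×_; _,_; proj₁; proj₂)
open import Data.Product.Function.NonDependent.Propositional using (_×-↔_)
open import Data.Sign as Sign using (Sign; opposite)
import Data.Sign.Properties as Sign
open import Data.Sum using (_⊎_; inj₁; inj₂)
open import Data.Vec using (Vec; []; _∷_; lookup; tabulate)
import Data.Vec.Properties as Vec
open import Function using (_∘_)
open import Function.Bundles using (_↔_; Inverse)
open import Function.Construct.Composition using (_↔-∘_)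
open import Function.Construct.Identity using (↔-id)
open import Function.Construct.Symmetry using (↔-sym)
open import Function.Properties.Inverse using (↔⇒↣)
open import Relation.Binary using (Irreflexive; Symmetric; Decidable; DecidableEquality)
open import Relation.Binary.PropositionalEquality
  using (_≡_; _≢_; refl; sym; trans; cong; cong₂; subst; subst₂)
open import Relation.Nullary using (¬_; Dec; yes; no; ¬?; _×-dec_; _⊎-dec_)
open import Relation.Nullary.Decidable using (map′)
import Relation.Unary as U

record Graph : Set₁ where
  infix 4 _~_ _~?_ _≟_
  field
    V      : Set
    order  : ℕ
    enum   : V ↔ Fin order
    _~_    : V → V → Set
    _~?_   : Decidable _~_
    ~-irr  : Irreflexive _≡_ _~_
    ~-sym  : Symmetric _~_

  _≟_ : DecidableEquality V
  _≟_ = Fin.inj⇒≟ (↔⇒↣ enum)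

  index : V → Fin order
  index = Inverse.to enum

  vertex : Fin order → V
  vertex = Inverse.from enum

  vertex-index : ∀ v → vertex (index v) ≡ v
  vertex-index = Inverse.strictlyInverseʳ enum

K : ℕ → Graph
K n = record
  { V      = Fin n
  ; order  = n
  ; enum   = ↔-id (Fin n)
  ; _~_    = _≢_
  ; _~?_   = λ i j → ¬? (i Fin.≟ j)
  ; ~-irr  = λ i≡j i≢j → i≢j i≡j
  ; ~-sym  = λ i≢j j≡i → i≢j (sym j≡i)
  }

infixl 8 _[_]ᴳ

_[_]ᴳ : Graph → Graph → Graph
G₁ [ G₂ ]ᴳ = record
  { V      = G₁.V × G₂.V
  ; order  = G₁.order ℕ.* G₂.order
  ; enum   = ↔-sym Fin.*↔× ↔-∘ (G₁.enum ×-↔ G₂.enum)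
  ; _~_    = λ (u , v) (u′ , v′) → (u G₁.~ u′) ⊎ (u ≡ u′ × v G₂.~ v′)
  ; _~?_   = λ (u , v) (u′ , v′) →
               (u G₁.~? u′) ⊎-dec ((u G₁.≟ u′) ×-dec (v G₂.~? v′))
  ; ~-irr  = λ { refl (inj₁ e)       → G₁.~-irr refl e
               ; refl (inj₂ (_ , e)) → G₂.~-irr refl e }
  ; ~-sym  = λ { (inj₁ e)       → inj₁ (G₁.~-sym e)
               ; (inj₂ (p , e)) → inj₂ (sym p , G₂.~-sym e) }
  }
  where module G₁ = Graph G₁
        module G₂ = Graph G₂

-- Adjacency proofs are passed irrelevantly, so that together with σ-sym the
-- signature is a function of the unordered edge uv.

record SignedGraph (G : Graph) : Set where
  open Graph G
  field
    σ     : (u v : V) → .(u ~ v) → Sign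
    σ-sym : ∀ {u v} (e : u ~ v) → σ u v e ≡ σ v u (~-sym e)

open SignedGraph

neg : ∀ {G} → SignedGraph G → SignedGraph G
neg S .σ u v e   = opposite (S .σ u v e)
neg S .σ-sym e   = cong opposite (S .σ-sym e)

AllPositive : ∀ {G} → SignedGraph G → Set
AllPositive {G} S = ∀ {u v} (e : u ~ v) → S .σ u v e ≡ Sign.+
  where open Graph G

-K : (n : ℕ) → SignedGraph (K n)
-K n .σ _ _ _   = Sign.-
-K n .σ-sym _   = refl

module _ {G₁ G₂ : Graph} where
  infixl 8 _[_]

  private
    module G₁ = Graph G₁
    module G₂ = Graph G₂
    module P  = Graph (G₁ [ G₂ ]ᴳ)

  private
    outer : ∀ {u u′ v v′} → u ≢ u′ → (u , v) P.~ (u′ , v′) → u G₁.~ u′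
    outer u≢u′ (inj₁ e)       = e
    outer u≢u′ (inj₂ (p , _)) = ⊥-elim (u≢u′ p)

    inner : ∀ {u u′ v v′} → u ≡ u′ → (u , v) P.~ (u′ , v′) → v G₂.~ v′
    inner p (inj₁ e)       = ⊥-elim (G₁.~-irr p e)
    inner p (inj₂ (_ , e)) = e

  -- The HG convention: edges between different copies of G₂ take the sign
  -- of S₁ alone.

  _[_] : SignedGraph G₁ → SignedGraph G₂ → SignedGraph (G₁ [ G₂ ]ᴳ)
  (S₁ [ S₂ ]) .σ (u , v) (u′ , v′) e with u G₁.≟ u′
  ... | yes u≡u′ = S₂ .σ v v′ (inner u≡u′ e)
  ... | no  u≢u′ = S₁ .σ u u′ (outer u≢u′ e)
  (S₁ [ S₂ ]) .σ-sym {u , v} {u′ , v′} e with u G₁.≟ u′ | u′ G₁.≟ u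
  ... | yes p | yes _ = S₂ .σ-sym (inner p e)
  ... | yes p | no ¬q = ⊥-elim (¬q (sym p))
  ... | no ¬p | yes q = ⊥-elim (¬p (sym q))
  ... | no ¬p | no  _ = S₁ .σ-sym (outer ¬p e)

module _ (G : Graph) where
  open Graph G

  data Walk : V → V → Set where
    []  : ∀ {u} → Walk u u
    _∷_ : ∀ {u v w} → u ~ v → Walk v w → Walk u w

module _ {G : Graph} where
  open Graph G

  -- The vertices of a walk without its endpoint; for a closed walk every
  -- vertex visited is therefore listed once per visit.

  vertices : ∀ {u v} → Walk G u v → List V
  vertices []            = List.[]
  vertices {u} (e ∷ w)   = u List.∷ vertices w

  IsCycle : ∀ {u} → Walk G u u → Set
  IsCycle w = Unique (vertices w) × 3 ≤ List.length (vertices w)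

  sign : SignedGraph G → ∀ {u v} → Walk G u v → Sign
  sign S []                        = Sign.+
  sign S (_∷_ {u} {v} e w)         = S .σ u v e Sign.* sign S w

  Balanced : SignedGraph G → Set
  Balanced S = ∀ {u} (w : Walk G u u) → IsCycle w → sign S w ≢ Sign.-

  Antibalanced : SignedGraph G → Set
  Antibalanced S = Balanced (neg S)

data Ω : Set where
  -1# 0# 1# : Ω

⟦_⟧ : Ω → ℤ
⟦ -1# ⟧ = -1ℤ
⟦ 0#  ⟧ = 0ℤ
⟦ 1#  ⟧ = 1ℤ

⟨_,_⟩ : ∀ {k} → Vec Ω k → Vec Ω k → ℤ
⟨ []     , []     ⟩ = 0ℤ
⟨ x ∷ xs , y ∷ ys ⟩ = ⟦ x ⟧ ℤ.* ⟦ y ⟧ ℤ.+ ⟨ xs , ys ⟩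

⟨⟩-comm : ∀ {k} (xs ys : Vec Ω k) → ⟨ xs , ys ⟩ ≡ ⟨ ys , xs ⟩
⟨⟩-comm []       []       = refl
⟨⟩-comm (x ∷ xs) (y ∷ ys) = cong₂ ℤ._+_ (ℤ.*-comm ⟦ x ⟧ ⟦ y ⟧) (⟨⟩-comm xs ys)

record SwitchingFunction (G : Graph) (k : ℕ) : Set where
  open Graph G
  field
    ζ       : V → Vec Ω k
    nonzero : ∀ {u v} → u ~ v → ⟨ ζ u , ζ v ⟩ ≢ 0ℤ

-- ℤ.sign maps 0 to +, but is only ever applied to nonzero integers here.

switch : ∀ {G k} → SignedGraph G → SwitchingFunction G k → SignedGraph G
switch S f .σ u v e = S .σ u v e Sign.* ℤ.sign ⟨ ζ u , ζ v ⟩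
  where open SwitchingFunction f
switch S f .σ-sym {u} {v} e =
  cong₂ Sign._*_ (S .σ-sym e) (cong ℤ.sign (⟨⟩-comm (ζ u) (ζ v)))
  where open SwitchingFunction f

Balanceable : ∀ {G} → SignedGraph G → ℕ → Set
Balanceable {G} S k = Σ (SwitchingFunction G k) λ f → AllPositive (switch S f)

record IsBalancingDimension {G} (S : SignedGraph G) (k : ℕ) : Set where
  field
    positive    : 1 ≤ k
    balanceable : Balanceable S k
    least       : ∀ {j} → 1 ≤ j → Balanceable S j → k ≤ j

-- Balanceability is decidable, by exhaustive search over V → Ω^k.

private
  Searchable : Set → Set₁
  Searchable A = ∀ {P : A → Set} → U.Decidable P → Dec (∃ P)

  searchΩ : Searchable Ω
  searchΩ P? with P? -1# | P? 0# | P? 1#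
  ... | yes p | _     | _     = yes (_ , p)
  ... | no _  | yes p | _     = yes (_ , p)
  ... | no _  | no _  | yes p = yes (_ , p)
  ... | no a  | no b  | no c  =
    no λ { (-1# , p) → a p ; (0# , p) → b p ; (1# , p) → c p }

  searchVec : ∀ {A} → Searchable A → ∀ n → Searchable (Vec A n)
  searchVec s zero    P? = map′ (λ p → [] , p) (λ { ([] , p) → p }) (P? [])
  searchVec s (suc n) P? =
    map′ (λ (x , xs , p) → x ∷ xs , p) (λ { (x ∷ xs , p) → x , xs , p })
         (s λ x → searchVec s n λ xs → P? (x ∷ xs))

module _ {G : Graph} (S : SignedGraph G) where
  open Graph G

  private
    Good : ∀ {k} → (V → Vec Ω k) → V → V → Set
    Good ζ u v = .(e : u ~ v) →
      ⟨ ζ u , ζ v ⟩ ≢ 0ℤ × S .σ u v e Sign.* ℤ.sign ⟨ ζ u , ζ v ⟩ ≡ Sign.+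

    good? : ∀ {k} (ζ : V → Vec Ω k) u v → Dec (Good ζ u v)
    good? ζ u v with u ~? v
    ... | no ¬e = yes λ e → ⊥-elim-irr (¬e e)
    ... | yes e =
      map′ (λ p _ → p) (λ p → p e)
        (¬? (⟨ ζ u , ζ v ⟩ ℤ.≟ 0ℤ)
          ×-dec (S .σ u v e Sign.* ℤ.sign ⟨ ζ u , ζ v ⟩ Sign.≟ Sign.+))

    Goodᵥ : ∀ {k} → Vec (Vec Ω k) order → Set
    Goodᵥ xs = ∀ i j → Good (lookup xs ∘ index) (vertex i) (vertex j)

    fromGood : ∀ {k} → ∃ (Goodᵥ {k}) → Balanceable S k
    fromGood (xs , g) =
      record { ζ = ζ ; nonzero = λ {u} {v} e → proj₁ (g′ u v e) }
        , λ {u} {v} e → proj₂ (g′ u v e)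
      where
      ζ = lookup xs ∘ index
      g′ : ∀ u v → Good ζ u v
      g′ u v = subst₂ (Good ζ) (vertex-index u) (vertex-index v)
                      (g (index u) (index v))

    toGood : ∀ {k} → Balanceable S k → ∃ (Goodᵥ {k})
    toGood (f , pos) = tabulate (ζ ∘ vertex) , good
      where
      open SwitchingFunction f
      ζ′ : V → Vec Ω _
      ζ′ = lookup (tabulate (ζ ∘ vertex)) ∘ index
      lookup-ζ : ∀ v → ζ v ≡ ζ′ v
      lookup-ζ v = sym (trans (Vec.lookup∘tabulate (ζ ∘ vertex) (index v))
                              (cong ζ (vertex-index v)))
      good : ∀ i j → Good ζ′ (vertex i) (vertex j)
      good i j e with vertex i ~? vertex j
      ... | no ¬e = ⊥-elim-irr (¬e e)
      ... | yes e′ =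
        subst₂ (λ x y → ⟨ x , y ⟩ ≢ 0ℤ × S .σ (vertex i) (vertex j) e′ Sign.* ℤ.sign ⟨ x , y ⟩ ≡ Sign.+)
               (lookup-ζ (vertex i)) (lookup-ζ (vertex j))
               (nonzero e′ , pos e′)

  balanceable? : U.Decidable (Balanceable S)
  balanceable? k = map′ fromGood toGood
    (searchVec (searchVec searchΩ k) order λ xs →
      Fin.all? λ i → Fin.all? λ j →
        good? (lookup xs ∘ index) (vertex i) (vertex j))

  -- Every signed graph is balanceable: use one coordinate per ordered pair
  -- (i , j) of vertices, in which i has entry 1, j has entry σ(ij) if i ~ j,
  -- and all other entries vanish.  (The leading 0# only serves to make the
  -- dimension positive for the empty graph.)

  private
    ofSign : Sign → Ω
    ofSign Sign.- = -1#
    ofSign Sign.+ = 1#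

    entry : V → V → V → Ω
    entry i j w with w ≟ i | w ≟ j | i ~? j
    ... | yes _ | _     | _     = 1#
    ... | no _  | yes _ | yes e = ofSign (S .σ i j e)
    ... | no _  | yes _ | no _  = 0#
    ... | no _  | no _  | _     = 0#

    unit : Sign → ℤ
    unit s = ⟦ ofSign s ⟧

    entry-prod : ∀ {u v} (e : u ~ v) i j →
      let p = ⟦ entry i j u ⟧ ℤ.* ⟦ entry i j v ⟧ in
      p ≡ 0ℤ ⊎ p ≡ unit (S .σ u v e)
    entry-prod {u} {v} e i j with u ≟ i | u ≟ j | v ≟ i | v ≟ j | i ~? j
    ... | yes refl | _        | yes refl | _        | _     = ⊥-elim (~-irr refl e)
    ... | yes refl | _        | no _     | yes refl | yes _ = inj₂ (ℤ.*-identityˡ _)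
    ... | yes refl | _        | no _     | yes refl | no ¬e = ⊥-elim (¬e e)
    ... | yes refl | _        | no _     | no _     | _     = inj₁ refl
    ... | no _     | yes refl | yes refl | _        | yes f =
      inj₂ (trans (ℤ.*-identityʳ _) (cong unit (S .σ-sym f)))
    ... | no _     | yes refl | yes refl | _        | no ¬f = ⊥-elim (¬f (~-sym e))
    ... | no _     | yes refl | no _     | yes refl | _     = ⊥-elim (~-irr refl e)
    ... | no _     | yes refl | no _     | no _     | yes f = inj₁ (ℤ.*-zeroʳ (unit (S .σ i j f)))
    ... | no _     | yes refl | no _     | no _     | no _  = inj₁ refl
    ... | no _     | no _     | _        | _        | _     = inj₁ refl

    entry-prod-uv : ∀ {u v} (e : u ~ v) →
      ⟦ entry u v u ⟧ ℤ.* ⟦ entry u v v ⟧ ≡ unit (S .σ u v e)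
    entry-prod-uv {u} {v} e with u ≟ u | v ≟ u | v ≟ v | u ~? v
    ... | no ¬p | _        | _     | _     = ⊥-elim (¬p refl)
    ... | yes _ | yes refl | _     | _     = ⊥-elim (~-irr refl e)
    ... | yes _ | no _     | no ¬p | _     = ⊥-elim (¬p refl)
    ... | yes _ | no _     | yes _ | no ¬e = ⊥-elim (¬e e)
    ... | yes _ | no _     | yes _ | yes _ = ℤ.*-identityˡ _

    data Has (s : Sign) : ℤ → Set where
      mk : ∀ n → Has s (s ℤ.◃ suc n)

    add : ∀ s {x y} → x ≡ 0ℤ ⊎ x ≡ unit s → Has s y → Has s (x ℤ.+ y)
    add s      (inj₁ refl) h      = subst (Has s) (sym (ℤ.+-identityˡ _)) h
    add Sign.- (inj₂ refl) (mk n) = mk (suc n)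
    add Sign.+ (inj₂ refl) (mk n) = mk (suc n)

    start : ∀ s {x y} → x ≡ unit s → y ≡ 0ℤ ⊎ Has s y → Has s (x ℤ.+ y)
    start s      p    (inj₂ h)    = add s (inj₂ p) h
    start Sign.- refl (inj₁ refl) = mk 0
    start Sign.+ refl (inj₁ refl) = mk 0

    module _ (s : Sign) where
      Term : Ω → Ω → Set
      Term x y = ⟦ x ⟧ ℤ.* ⟦ y ⟧ ≡ 0ℤ ⊎ ⟦ x ⟧ ℤ.* ⟦ y ⟧ ≡ unit s

      sum₀ : ∀ {n} (f g : Fin n → Ω) → (∀ i → Term (f i) (g i)) →
             ⟨ tabulate f , tabulate g ⟩ ≡ 0ℤ ⊎ Has s ⟨ tabulate f , tabulate g ⟩
      sum₀ {zero}  f g t = inj₁ refl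
      sum₀ {suc n} f g t with t zero | sum₀ (f ∘ suc) (g ∘ suc) (t ∘ suc)
      ... | inj₁ p | inj₁ q = inj₁ (cong₂ ℤ._+_ p q)
      ... | inj₁ p | inj₂ h = inj₂ (add s (inj₁ p) h)
      ... | inj₂ p | r      = inj₂ (start s p r)

      sum₁ : ∀ {n} (f g : Fin n → Ω) → (∀ i → Term (f i) (g i)) →
             ∀ i → ⟦ f i ⟧ ℤ.* ⟦ g i ⟧ ≡ unit s →
             Has s ⟨ tabulate f , tabulate g ⟩
      sum₁ f g t zero    p = start s p (sum₀ (f ∘ suc) (g ∘ suc) (t ∘ suc))
      sum₁ f g t (suc i) p = add s (t zero) (sum₁ (f ∘ suc) (g ∘ suc) (t ∘ suc) i p)

    has⇒≢0 : ∀ {s x} → Has s x → x ≢ 0ℤ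
    has⇒≢0 {Sign.-} (mk n) ()
    has⇒≢0 {Sign.+} (mk n) ()

    has⇒+ : ∀ {s x} → Has s x → s Sign.* ℤ.sign x ≡ Sign.+
    has⇒+ {Sign.-} (mk n) = refl
    has⇒+ {Sign.+} (mk n) = refl

    pair : Fin (order ℕ.* order) → V × V
    pair c = vertex (proj₁ (remQuot order c)) , vertex (proj₂ (remQuot {order} order c))

    ζ₀ : V → Vec Ω (suc (order ℕ.* order))
    ζ₀ w = 0# ∷ tabulate λ c → entry (proj₁ (pair c)) (proj₂ (pair c)) w

    has₀ : ∀ {u v} (e : u ~ v) → Has (S .σ u v e) ⟨ ζ₀ u , ζ₀ v ⟩
    has₀ {u} {v} e = add s (inj₁ refl)
      (sum₁ s _ _ (λ c → entry-prod e (proj₁ (pair c)) (proj₂ (pair c))) c₀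
        (subst (λ p → ⟦ entry (proj₁ p) (proj₂ p) u ⟧ ℤ.* ⟦ entry (proj₁ p) (proj₂ p) v ⟧ ≡ unit s)
               (sym pair-c₀) (entry-prod-uv e)))
      where
      s  = S .σ u v e
      c₀ = combine (index u) (index v)
      pair-c₀ : pair c₀ ≡ (u , v)
      pair-c₀ = trans
        (cong (λ q → vertex (proj₁ q) , vertex (proj₂ q)) (Fin.remQuot-combine (index u) (index v)))
        (cong₂ _,_ (vertex-index u) (vertex-index v))

  balanceable : Balanceable S (suc (order ℕ.* order))
  balanceable = record { ζ = ζ₀ ; nonzero = λ e → has⇒≢0 (has₀ e) } , λ e → has⇒+ (has₀ e)

  private
    search : ∀ d {k} → 1 ≤ k → (∀ {j} → 1 ≤ j → Balanceable S j → k ≤ j) →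
             Balanceable S (d ℕ.+ k) → ∃ (IsBalancingDimension S)
    search zero    {k} 1≤k below b = k , record
      { positive = 1≤k ; balanceable = b ; least = below }
    search (suc d) {k} 1≤k below b with balanceable? k
    ... | yes p = k , record { positive = 1≤k ; balanceable = p ; least = below }
    ... | no ¬p = search d (s≤s z≤n)
      (λ 1≤j q → ℕ.≤∧≢⇒< (below 1≤j q) λ { refl → ¬p q })
      (subst (Balanceable S) (sym (ℕ.+-suc d k)) b)

    bdim-exists : ∃ (IsBalancingDimension S)
    bdim-exists = search (order ℕ.* order) (s≤s z≤n) (λ 1≤j _ → 1≤j)
      (subst (Balanceable S) (ℕ.+-comm 1 (order ℕ.* order)) balanceable)

  abstract
    bdim : ℕ
    bdim = proj₁ bdim-exists

    bdim-isBalancingDimension : IsBalancingDimension S bdim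
    bdim-isBalancingDimension = proj₂ bdim-exists

{-# OPTIONS --safe #-}

-- Triangles through a fixed root show that an antibalanced signature of a
-- complete graph is σ(uv) = − s(u) s(v).  If Σ₁ is given in this way by s, then
-- so is Σ₁[−Kₙ] by (u , v) ↦ s(u): inside a copy of Kₙ the product s(u) s(u)
-- is +, which matches the all-negative signature.  As the graph of Σ₁[−Kₙ] is
-- complete, it is isomorphic to K⁻ up to ±1-switching, and a ±1-switching can
-- be absorbed into a vector valued switching function.

module Submission where

open import Defs
open import Data.Empty using (⊥-elim)
open import Data.Fin using (Fin; zero; suc)
import Data.Fin.Properties as Fin
open import Data.Integer as ℤ using (ℤ; 0ℤ)
import Data.Integer.Properties as ℤ
open import Data.List.Relation.Unary.All as All using ()
open import Data.List.Relation.Unary.AllPairs as AllPairs using ()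
open import Data.List.Relation.Unary.Unique.Propositional using (Unique)
open import Data.Nat using (ℕ; zero; suc; _*_; _≤_; z≤n; s≤s)
import Data.Nat.Properties as ℕ
open import Data.Product using (∃; _,_; proj₁)
open import Data.Sign as Sign using (Sign; opposite)
import Data.Sign.Properties as Sign
open import Data.Sum using (inj₁; inj₂)
open import Data.Vec as Vec using (Vec; []; _∷_)
open import Function using (_∘_)
open import Function.Bundles using (_↔_; Inverse; Injection)
open import Function.Construct.Symmetry using (↔-sym)
open import Function.Properties.Inverse using (↔⇒↣)
open import Relation.Binary.PropositionalEquality
  using (_≡_; _≢_; refl; sym; trans; cong; cong₂; subst; module ≡-Reasoning)
open import Relation.Nullary using (yes; no)

open SignedGraph
open import Algebra.Properties.CommutativeSemigroup Sign.*-commutativeSemigroup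
  using (interchange)

infixr 8 _•Ω_ _•_ _•ℤ_

_•Ω_ : Sign → Ω → Ω
Sign.+ •Ω x   = x
Sign.- •Ω -1# = 1#
Sign.- •Ω 0#  = 0#
Sign.- •Ω 1#  = -1#

_•_ : ∀ {k} → Sign → Vec Ω k → Vec Ω k
s • xs = Vec.map (s •Ω_) xs

_•ℤ_ : Sign → ℤ → ℤ
Sign.+ •ℤ i = i
Sign.- •ℤ i = ℤ.- i

•ℤ-distrib-+ : ∀ s i j → s •ℤ (i ℤ.+ j) ≡ s •ℤ i ℤ.+ s •ℤ j
•ℤ-distrib-+ Sign.+ i j = refl
•ℤ-distrib-+ Sign.- i j = ℤ.neg-distrib-+ i j

•ℤ-* : ∀ s t i j → s •ℤ i ℤ.* t •ℤ j ≡ (s Sign.* t) •ℤ (i ℤ.* j)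
•ℤ-* Sign.+ Sign.+ i j = refl
•ℤ-* Sign.+ Sign.- i j = sym (ℤ.neg-distribʳ-* i j)
•ℤ-* Sign.- Sign.+ i j = sym (ℤ.neg-distribˡ-* i j)
•ℤ-* Sign.- Sign.- i j = begin
  ℤ.- i ℤ.* ℤ.- j       ≡⟨ ℤ.neg-distribˡ-* i (ℤ.- j) ⟨
  ℤ.- (i ℤ.* ℤ.- j)     ≡⟨ cong ℤ.-_ (ℤ.neg-distribʳ-* i j) ⟨
  ℤ.- (ℤ.- (i ℤ.* j))   ≡⟨ ℤ.neg-involutive (i ℤ.* j) ⟩
  i ℤ.* j               ∎
  where open ≡-Reasoning

⟦•Ω⟧ : ∀ s x → ⟦ s •Ω x ⟧ ≡ s •ℤ ⟦ x ⟧
⟦•Ω⟧ Sign.+ x   = refl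
⟦•Ω⟧ Sign.- -1# = refl
⟦•Ω⟧ Sign.- 0#  = refl
⟦•Ω⟧ Sign.- 1#  = refl

⟨•,•⟩ : ∀ {k} s t (xs ys : Vec Ω k) → ⟨ s • xs , t • ys ⟩ ≡ (s Sign.* t) •ℤ ⟨ xs , ys ⟩
-- `_•ℤ_` reduces only on a concrete sign, so the empty vectors need both signs split.
⟨•,•⟩ Sign.+ Sign.+ [] [] = refl
⟨•,•⟩ Sign.+ Sign.- [] [] = refl
⟨•,•⟩ Sign.- Sign.+ [] [] = refl
⟨•,•⟩ Sign.- Sign.- [] [] = refl
⟨•,•⟩ s t (x ∷ xs) (y ∷ ys) = trans
  (cong₂ ℤ._+_
    (trans (cong₂ ℤ._*_ (⟦•Ω⟧ s x) (⟦•Ω⟧ t y)) (•ℤ-* s t ⟦ x ⟧ ⟦ y ⟧))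
    (⟨•,•⟩ s t xs ys))
  (sym (•ℤ-distrib-+ (s Sign.* t) (⟦ x ⟧ ℤ.* ⟦ y ⟧) ⟨ xs , ys ⟩))

•ℤ-≢0 : ∀ s {i} → i ≢ 0ℤ → s •ℤ i ≢ 0ℤ
•ℤ-≢0 Sign.+ i≢0 = i≢0
•ℤ-≢0 Sign.- i≢0 = i≢0 ∘ ℤ.neg-injective

-- At 0 negation would leave the sign `+` unchanged; elsewhere it flips the sign.
sign-•ℤ : ∀ s {i} → i ≢ 0ℤ → ℤ.sign (s •ℤ i) ≡ s Sign.* ℤ.sign i
sign-•ℤ Sign.+              i≢0 = refl
sign-•ℤ Sign.- {ℤ.+ zero}   i≢0 = ⊥-elim (i≢0 refl)
sign-•ℤ Sign.- {ℤ.+ suc n}  i≢0 = refl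
sign-•ℤ Sign.- {ℤ.-[1+ n ]} i≢0 = refl

-- Equivalently, `S` arises from the all-negative signature by ±1-switching with `s`.
record IsPotential {G} (S : SignedGraph G) (s : Graph.V G → Sign) : Set where
  constructor isPotential
  open Graph G
  field
    σ≡ : ∀ {u v} (e : u ~ v) → S .σ u v e ≡ opposite (s u Sign.* s v)

open IsPotential using (σ≡)

-- Here `p` and `q` stand for the products of potentials at the ends of an edge and of its image:
-- the factor `p * q` trades one signature for the other.
opposite-cancel : ∀ p q x → opposite p Sign.* ((p Sign.* q) Sign.* x) ≡ opposite q Sign.* x
opposite-cancel Sign.+ Sign.+ x = refl
opposite-cancel Sign.+ Sign.- x = Sign.opposite-involutive x
opposite-cancel Sign.- Sign.+ x = refl
opposite-cancel Sign.- Sign.- x = refl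

-- Along `φ` the two signatures differ by a ±1-switching. Since `Ω` is closed under negation, that
-- switching is absorbed into the vectors without changing the dimension.
balanceable-pullback : ∀ {G H} {S : SignedGraph G} {T : SignedGraph H} {s t} →
  IsPotential S s → IsPotential T t →
  (φ : Graph.V G → Graph.V H) → (∀ {u v} → Graph._~_ G u v → Graph._~_ H (φ u) (φ v)) →
  ∀ {k} → Balanceable T k → Balanceable S k
balanceable-pullback {G} {H} {S} {T} {s} {t} S-pot T-pot φ φ-hom {k} (f , f-pos) =
  record { ζ = ζ′ ; nonzero = λ e → subst (_≢ 0ℤ) (sym (⟨ζ′⟩ _ _))
             (•ℤ-≢0 (r _ Sign.* r _) (nonzero (φ-hom e))) } , pos
  where
  open Graph G
  open SwitchingFunction f
  open ≡-Reasoning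

  -- Multiplying by `s` undoes the potential of `S`, and multiplying by `t` installs that of `T`.
  r : V → Sign
  r u = s u Sign.* t (φ u)

  ζ′ : V → Vec Ω k
  ζ′ u = r u • ζ (φ u)

  ⟨ζ′⟩ : ∀ u v → ⟨ ζ′ u , ζ′ v ⟩ ≡ (r u Sign.* r v) •ℤ ⟨ ζ (φ u) , ζ (φ v) ⟩
  ⟨ζ′⟩ u v = ⟨•,•⟩ (r u) (r v) (ζ (φ u)) (ζ (φ v))

  pos : ∀ {u v} (e : u ~ v) → S .σ u v e Sign.* ℤ.sign ⟨ ζ′ u , ζ′ v ⟩ ≡ Sign.+
  pos {u} {v} e = begin
    S .σ u v e Sign.* ℤ.sign ⟨ ζ′ u , ζ′ v ⟩
      ≡⟨ cong₂ Sign._*_ (S-pot .σ≡ e)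
          (trans (cong ℤ.sign (⟨ζ′⟩ u v)) (sign-•ℤ (r u Sign.* r v) (nonzero (φ-hom e)))) ⟩
    opposite s² Sign.* ((r u Sign.* r v) Sign.* x)
      ≡⟨ cong (λ p → opposite s² Sign.* (p Sign.* x)) (interchange (s u) (t (φ u)) (s v) (t (φ v))) ⟩
    opposite s² Sign.* ((s² Sign.* t²) Sign.* x)
      ≡⟨ opposite-cancel s² t² x ⟩
    opposite t² Sign.* x
      ≡⟨ cong (Sign._* x) (T-pot .σ≡ (φ-hom e)) ⟨
    T .σ (φ u) (φ v) (φ-hom e) Sign.* x
      ≡⟨ f-pos (φ-hom e) ⟩
    Sign.+ ∎
    where
    s² = s u Sign.* s v
    t² = t (φ u) Sign.* t (φ v)
    x  = ℤ.sign ⟨ ζ (φ u) , ζ (φ v) ⟩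

bdim-mono : ∀ {G H} {S : SignedGraph G} {T : SignedGraph H} →
  (∀ {k} → Balanceable T k → Balanceable S k) → bdim S ≤ bdim T
bdim-mono {S = S} {T} pull = S.least T.positive (pull T.balanceable)
  where
  module S = IsBalancingDimension (bdim-isBalancingDimension S)
  module T = IsBalancingDimension (bdim-isBalancingDimension T)

Complete : Graph → Set
Complete G = ∀ {u v} → u ≢ v → u ~ v
  where open Graph G

-- A bijection between complete graphs preserves adjacency in both directions, because it keeps
-- distinct vertices distinct; pulling back each way gives the two inequalities.
bdim-cong : ∀ {G H} {S : SignedGraph G} {T : SignedGraph H} {s t} →
  Complete G → Complete H → Graph.V G ↔ Graph.V H →
  IsPotential S s → IsPotential T t → bdim S ≡ bdim T
bdim-cong {G} {H} {S} {T} G-complete H-complete iso S-pot T-pot = ℕ.≤-antisym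
  (bdim-mono (balanceable-pullback S-pot T-pot to
    λ e → H-complete λ p → Graph.~-irr G (injective iso p) e))
  (bdim-mono (balanceable-pullback T-pot S-pot from
    λ e → G-complete λ p → Graph.~-irr H (injective (↔-sym iso) p) e))
  where
  open Inverse iso using (to; from)
  injective : ∀ {A B : Set} (f : A ↔ B) {x y} → Inverse.to f x ≡ Inverse.to f y → x ≡ y
  injective f = Injection.injective (↔⇒↣ f)

-- The hypothesis has the shape of `sign (neg S)` on a walk of three edges, the final `+` coming
-- from `[]`. The conclusion is the potential equation for the edge opposite the root, whose ends
-- have potentials `opposite a` and `opposite c`.
triangle-sign : ∀ a b c →
  opposite a Sign.* (opposite b Sign.* (opposite c Sign.* Sign.+)) ≢ Sign.- →
  b ≡ opposite (opposite a Sign.* opposite c)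
triangle-sign Sign.+ Sign.+ Sign.+ ≢- = ⊥-elim (≢- refl)
triangle-sign Sign.+ Sign.+ Sign.- ≢- = refl
triangle-sign Sign.+ Sign.- Sign.+ ≢- = refl
triangle-sign Sign.+ Sign.- Sign.- ≢- = ⊥-elim (≢- refl)
triangle-sign Sign.- Sign.+ Sign.+ ≢- = refl
triangle-sign Sign.- Sign.+ Sign.- ≢- = ⊥-elim (≢- refl)
triangle-sign Sign.- Sign.- Sign.+ ≢- = ⊥-elim (≢- refl)
triangle-sign Sign.- Sign.- Sign.- ≢- = refl

antibalanced⇒potential : ∀ {n} (S : SignedGraph (K n)) → Antibalanced S → ∃ (IsPotential S)
antibalanced⇒potential {zero}  S anti = (λ ()) , isPotential λ { {()} }
antibalanced⇒potential {suc n} S anti = s , isPotential pot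
  where
  open Graph (K (suc n)) using (~-sym)

  s : Fin (suc n) → Sign
  -- With the root normalised to `+`, the edges at the root force all other values.
  s zero    = Sign.+
  s (suc i) = opposite (S .σ zero (suc i) Fin.0≢1+n)

  pot : ∀ {u v} (e : u ≢ v) → S .σ u v e ≡ opposite (s u Sign.* s v)
  pot {zero}  {zero}  e = ⊥-elim (e refl)
  pot {zero}  {suc j} e = sym (Sign.opposite-involutive _)
  pot {suc i} {zero}  e = begin
    S .σ (suc i) zero e                  ≡⟨ S .σ-sym e ⟩
    S .σ zero (suc i) (~-sym e)          ≡⟨ Sign.opposite-involutive _ ⟨
    opposite (s (suc i))                 ≡⟨ cong opposite (Sign.*-identityʳ (s (suc i))) ⟨
    opposite (s (suc i) Sign.* Sign.+)   ∎
    where open ≡-Reasoning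
  pot {suc i} {suc j} e = triangle-sign a b c
    -- The triangle traverses its last edge towards the root, while `c` reads it from the root.
    (subst (λ c → opposite a Sign.* (opposite b Sign.* (opposite c Sign.* Sign.+)) ≢ Sign.-)
      (S .σ-sym (~-sym 0≢j))
      (anti triangle (distinct , s≤s (s≤s (s≤s z≤n)))))
    where
    0≢i : zero ≢ suc i
    0≢i = Fin.0≢1+n
    0≢j : zero ≢ suc j
    0≢j = Fin.0≢1+n
    triangle : Walk (K (suc n)) zero zero
    triangle = 0≢i ∷ e ∷ ~-sym 0≢j ∷ []
    distinct : Unique (vertices triangle)
    distinct = (0≢i All.∷ 0≢j All.∷ All.[]) AllPairs.∷ (e All.∷ All.[]) AllPairs.∷
               All.[] AllPairs.∷ AllPairs.[]
    a = S .σ zero (suc i) 0≢i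
    b = S .σ (suc i) (suc j) e
    c = S .σ zero (suc j) 0≢j

K[K]-complete : ∀ m n → Complete (K m [ K n ]ᴳ)
K[K]-complete m n {u , v} {u′ , v′} p with u Fin.≟ u′
... | no  u≢u′ = inj₁ u≢u′
... | yes refl = inj₂ (refl , p ∘ cong (u ,_))

[-K]-potential : ∀ {G} (S : SignedGraph G) n {s} →
  IsPotential S s → IsPotential (S [ -K n ]) (s ∘ proj₁)
[-K]-potential {G} S n {s} pot = isPotential σ≡′
  where
  open Graph (G [ K n ]ᴳ) using (_~_)

  σ≡′ : ∀ {p q} (e : p ~ q) → (S [ -K n ]) .σ p q e ≡ opposite (s (proj₁ p) Sign.* s (proj₁ q))
  -- The product signature branches on `u ≟ u′`; splitting `e` too yields the adjacency in `G` when
  -- the copies differ.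
  σ≡′ {u , _} {u′ , _} e with Graph._≟_ G u u′ | e
  ... | yes refl | _                = cong opposite (sym (Sign.s*s≡+ (s u)))
  ... | no  _    | inj₁ u~u′        = pot .σ≡ u~u′
  ... | no  u≢u′ | inj₂ (u≡u′ , _)  = ⊥-elim (u≢u′ u≡u′)

proposition2p17 : (m n : ℕ)
    (Σ₁ : SignedGraph (K m)) → Antibalanced Σ₁ →
    (K⁻ : SignedGraph (K (m * n))) → Antibalanced K⁻ →
    bdim (Σ₁ [ -K n ]) ≡ bdim K⁻
proposition2p17 m n Σ₁ Σ₁-anti K⁻ K⁻-anti
  with antibalanced⇒potential Σ₁ Σ₁-anti | antibalanced⇒potential K⁻ K⁻-anti
... | _ , Σ₁-pot | _ , K⁻-pot =
  -- Adjacency in `K (m * n)` is inequality by definition, so its completeness is the identity.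
  bdim-cong (K[K]-complete m n) (λ p → p) (↔-sym Fin.*↔×)
    ([-K]-potential Σ₁ n Σ₁-pot) K⁻-pot
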